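{- Let $G=(V,E)$ be a finite graph with a fixed total ordering of its edges. The Hasse diagram of the Boolean lattice $2^E$ has an acyclic matching $\mathrm{M}_{\mathrm{BC}}$ in which each matched pair $S\lessdot S'$ satisfies $k(S)=k(S')$ and $\lambda(S)=\lambda(S')$, and whose set of critical (unmatched) vertices is $\mathrm{M}_{\mathrm{BC}}^0=\mathrm{NBC}$.
   Context: A finite graph $G=(V,E)$ consists of a finite set $V$ and a set $E$ of 2-element subsets of $V$. A cycle is (the edge set of) a closed sequence $x_1,\dots,x_k,x_1$ with $k\ge 3$, $x_1,\dots,x_k$ distinct vertices and each $\{x_i,x_{i+1}\}$ an edge (indices mod $k$). Fix an ordering $e_1,\dots,e_m$ of $E$. A broken circuit is a set $C\setminus\{e\}$ where $C\subseteq E$ is a cycle and $e$ is the edge of $C$ with the largest label. $\mathrm{NBC}$ is the set of all $S\subseteq E$ that contain no broken circuit. A subset $S\subseteq E$ is identified with the spanning subgraph with vertex set $V$ and edge set $S$; $k(S)$ is its number of connected components and $\lambda(S)$ is the set partition of $V$ into the connected components of $S$. $2^E$ is the poset of subsets of $E$ ordered by inclusion; $S\lessdot S'$ denotes a cover relation. Its Hasse diagram is the directed graph with vertex set $2^E$ and an edge $S\to S'$ whenever $S\lessdot S'$. A matching $M$ on a directed graph is a collection of pairwise disjoint edges; it is acyclic if reversing the direction of all edges in $M$ produces a directed graph with no directed cycles; $M^0$ is the set of vertices not incident with any edge of $M$. -}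

module Defs where

open import Level using (0ℓ)
open import Data.Bool.Properties as Bool using ()
open import Data.Fin.Base using (Fin; toℕ; _≤_)
open import Data.Fin.Properties using (_≟_; any?)
open import Data.Fin.Subset using (Subset; ∣_∣; ⁅_⁆; _∪_; _∈_; _⊆_; _⊂_; _-_)
open import Data.Fin.Subset.Properties using (_∈?_)
open import Data.List.Base using (List; []; _∷_; allFin; deduplicate; length; map)
open import Data.List.Membership.Propositional using () renaming (_∈_ to _∈ˡ_)
open import Data.List.Membership.Propositional.Properties using (∈-allFin)
open import Data.List.Relation.Unary.Any using (here; there)
open import Data.Nat.Base as ℕ using (ℕ; suc)
open import Data.Nat.DivMod using (_mod_)
open import Data.Product.Base using (∃-syntax; _×_; _,_)
open import Data.Sum.Base using (_⊎_; inj₁; inj₂)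
open import Data.Vec.Base using (tabulate)
open import Data.Vec.Properties using (≡-dec)
open import Function.Bundles using (_⇔_)
open import Function.Definitions using (Injective)
open import Relation.Binary.Construct.Closure.ReflexiveTransitive
  using (Star; ε; _◅_; _◅◅_)
open import Relation.Binary.Construct.Closure.Transitive using (TransClosure)
open import Relation.Binary.Core using (Rel; _⇒_)
open import Relation.Binary.Definitions using (Decidable; DecidableEquality; Irreflexive)
open import Relation.Binary.PropositionalEquality using (_≡_; refl)
open import Relation.Nullary.Decidable
  using (does; _×-dec_; _⊎-dec_; map′)
open import Relation.Nullary.Negation using (¬_)
open import Relation.Unary using (Pred)

------------------------------------------------------------------------
-- Matchings on directed graphs

-- A directed graph on a vertex set A is given by its edge relation; a
-- collection of edges is a subrelation.

module _ {A : Set} where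

  data Endpoint (v : A) : A × A → Set where
    source : ∀ {b} → Endpoint v (v , b)
    target : ∀ {a} → Endpoint v (a , v)

  record IsMatching (E M : Rel A 0ℓ) : Set where
    field
      edges    : M ⇒ E
      disjoint : ∀ {a b c d v} → M a b → M c d →
                 Endpoint v (a , b) → Endpoint v (c , d) → (a , b) ≡ (c , d)

  Reverse : (E M : Rel A 0ℓ) → Rel A 0ℓ
  Reverse E M a b = (E a b × ¬ M a b) ⊎ M b a

  -- A directed graph has a directed cycle exactly when it has a closed
  -- walk of positive length.
  NoDirectedCycle : Rel A 0ℓ → Set
  NoDirectedCycle R = Irreflexive _≡_ (TransClosure R)

  record IsAcyclicMatching (E M : Rel A 0ℓ) : Set where
    field
      isMatching : IsMatching E M
      acyclic    : NoDirectedCycle (Reverse E M)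

  Critical : Rel A 0ℓ → Pred A 0ℓ
  Critical M v = ¬ (∃[ a ] ∃[ b ] M a b × Endpoint v (a , b))

------------------------------------------------------------------------
-- The Boolean lattice

infix 4 _⋖_

_⋖_ : ∀ {m} → Rel (Subset m) 0ℓ
S ⋖ T = S ⊂ T × ¬ (∃[ U ] S ⊂ U × U ⊂ T)

------------------------------------------------------------------------
-- Deciding reachability in a finite directed graph

module Reachability {n} {R : Rel (Fin n) 0ℓ} (R? : Decidable R) where

  -- Walks all of whose intermediate vertices are in the list
  -- (the Floyd–Warshall recursion).
  Via : List (Fin n) → Rel (Fin n) 0ℓ
  Via []       u v = u ≡ v ⊎ R u v
  Via (p ∷ ps) u v = Via ps u v ⊎ (Via ps u p × Via ps p v)

  via? : ∀ ps → Decidable (Via ps)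
  via? []       u v = (u ≟ v) ⊎-dec R? u v
  via? (p ∷ ps) u v = via? ps u v ⊎-dec (via? ps u p ×-dec via? ps p v)

  via⇒star : ∀ ps {u v} → Via ps u v → Star R u v
  via⇒star []       (inj₁ refl)    = ε
  via⇒star []       (inj₂ r)       = r ◅ ε
  via⇒star (p ∷ ps) (inj₁ w)       = via⇒star ps w
  via⇒star (p ∷ ps) (inj₂ (w , z)) = via⇒star ps w ◅◅ via⇒star ps z

  via-refl : ∀ ps {u} → Via ps u u
  via-refl []       = inj₁ refl
  via-refl (p ∷ ps) = inj₁ (via-refl ps)

  via-step : ∀ ps {u v} → R u v → Via ps u v
  via-step []       r = inj₂ r
  via-step (p ∷ ps) r = inj₁ (via-step ps r)

  via-trans : ∀ ps {u x v} → x ∈ˡ ps → Via ps u x → Via ps x v → Via ps u v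
  via-trans (p ∷ ps) (here refl) w z = inj₂ (to w , from z)
    where
    to : ∀ {u} → Via (p ∷ ps) u p → Via ps u p
    to (inj₁ a)       = a
    to (inj₂ (a , _)) = a
    from : ∀ {v} → Via (p ∷ ps) p v → Via ps p v
    from (inj₁ a)       = a
    from (inj₂ (_ , a)) = a
  via-trans (p ∷ ps) (there x∈) (inj₁ w) (inj₁ z) = inj₁ (via-trans ps x∈ w z)
  via-trans (p ∷ ps) (there x∈) (inj₁ w) (inj₂ (z , z′)) =
    inj₂ (via-trans ps x∈ w z , z′)
  via-trans (p ∷ ps) (there x∈) (inj₂ (w , w′)) (inj₁ z) =
    inj₂ (w , via-trans ps x∈ w′ z)
  via-trans (p ∷ ps) (there x∈) (inj₂ (w , _)) (inj₂ (_ , z)) = inj₂ (w , z)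

  star⇒via : ∀ {u v} → Star R u v → Via (allFin n) u v
  star⇒via ε        = via-refl (allFin n)
  star⇒via (r ◅ rs) =
    via-trans (allFin n) (∈-allFin _) (via-step (allFin n) r) (star⇒via rs)

  star? : Decidable (Star R)
  star? u v = map′ (via⇒star (allFin n)) star⇒via (via? (allFin n) u v)

------------------------------------------------------------------------
-- Graphs with totally ordered edges

-- The edges are e₁ < ⋯ < eₘ in the order of Fin m; edge sets are
-- accordingly elements of Subset m.
record Graph : Set where
  field
    n m            : ℕ
    edge           : Fin m → Subset n
    edge-size      : ∀ e → ∣ edge e ∣ ≡ 2
    edge-injective : Injective _≡_ _≡_ edge

_≟ˢ_ : ∀ {n} → DecidableEquality (Subset n)
_≟ˢ_ = ≡-dec Bool._≟_

next : ∀ {k} → Fin k → Fin k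
next {suc k} i = suc (toℕ i) mod suc k

module _ (G : Graph) where

  open Graph G

  Joins : Fin m → Fin n → Fin n → Set
  Joins e u v = edge e ≡ ⁅ u ⁆ ∪ ⁅ v ⁆

  record IsCycle (C : Subset m) : Set where
    field
      k        : ℕ
      3≤k      : 3 ℕ.≤ k
      x        : Fin k → Fin n
      distinct : Injective _≡_ _≡_ x
      closed   : ∀ i → ∃[ e ] Joins e (x i) (x (next i))
      edgeSet  : ∀ e → e ∈ C ⇔ (∃[ i ] Joins e (x i) (x (next i)))

  IsBrokenCircuit : Pred (Subset m) 0ℓ
  IsBrokenCircuit B =
    ∃[ C ] ∃[ e ] IsCycle C × e ∈ C × (∀ f → f ∈ C → f ≤ e) × B ≡ C - e

  NBC : Pred (Subset m) 0ℓ
  NBC S = ¬ (∃[ B ] IsBrokenCircuit B × B ⊆ S)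

  Adjacent : Subset m → Rel (Fin n) 0ℓ
  Adjacent S u v = ∃[ e ] e ∈ S × Joins e u v

  Connected : Subset m → Rel (Fin n) 0ℓ
  Connected S = Star (Adjacent S)

  adjacent? : ∀ S → Decidable (Adjacent S)
  adjacent? S u v = any? λ e → (e ∈? S) ×-dec (edge e ≟ˢ (⁅ u ⁆ ∪ ⁅ v ⁆))

  connected? : ∀ S → Decidable (Connected S)
  connected? S = Reachability.star? (adjacent? S)

  component : Subset m → Fin n → Subset n
  component S v = tabulate λ w → does (connected? S v w)

  -- The set partition λ(S), as a repetition-free list of its blocks (to be
  -- compared as a set), and the number k(S) of components.
  components : Subset m → List (Subset n)
  components S = deduplicate _≟ˢ_ (map (component S) (allFin n))

  #components : Subset m → ℕ
  #components S = length (components S)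

{-# OPTIONS --safe #-}

-- Call an edge e active in S if its ends are joined by a walk in S using only
-- edges smaller than e, i.e. if S contains the broken circuit of a cycle with
-- largest edge e. Adding or removing an active edge changes no connectivity,
-- hence not the set of active edges, so toggling the least active edge is a
-- matching whose critical sets are those without active edges. Along a closed
-- walk of the modified Hasse diagram the set of active edges grows, hence is
-- constant, so a single edge e is toggled throughout; once removed it is never
-- put back, since adding it would be a matched step.

module Submission where

open import Defs
open import Level using (0ℓ)
open import Data.Empty using (⊥-elim)
open import Data.Fin.Base using (Fin; zero; suc; fromℕ; inject₁; toℕ; _<_; _≤_)
open import Data.Fin.Induction using (>-weakInduction)
open import Data.Fin.Properties as Fin using (any?)
open import Data.Fin.Relation.Unary.Top using (view; ‵fromℕ; ‵inject₁)
open import Data.Fin.Subset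
  using (Subset; ⁅_⁆; ∣_∣; _∪_; _-_; _∈_; _∉_; _⊆_; _⊂_)
open import Data.Fin.Subset.Properties
open import Data.List.Base using (allFin; deduplicate; length)
open import Data.List.Membership.Propositional using () renaming (_∈_ to _∈ˡ_)
open import Data.List.Properties using (map-cong)
open import Data.List.Relation.Binary.BagAndSetEquality using (_∼[_]_; set)
open import Data.Nat.Base as ℕ using (ℕ; zero; suc; z≤n; s≤s)
open import Data.Nat.DivMod using (m<n⇒m%n≡m; n%n≡0)
import Data.Nat.Properties as ℕ
open import Data.Product.Base using (Σ-syntax; ∃; ∃-syntax; _×_; _,_; proj₁; proj₂)
open import Data.Sum.Base using (_⊎_; inj₁; inj₂; [_,_]′)
open import Data.Vec.Base using (tabulate)
open import Data.Vec.Functional using () renaming (_∷_ to _◂_)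
open import Data.Vec.Properties
  using (tabulate-cong; lookup∘tabulate; lookup⇒[]=; []=⇒lookup)
open import Function.Base using (id; _∘_; case_of_)
open import Function.Bundles using (mk⇔; _⇔_; module Equivalence)
open import Function.Definitions using (Injective)
open import Function.Related.Propositional using (K-refl)
open import Relation.Binary.Construct.Closure.ReflexiveTransitive
  using (Star; ε; _◅_; kleisliStar; return; reverse)
open import Relation.Binary.Construct.Closure.Transitive using (TransClosure; [_]; _∷_)
open import Relation.Binary.Core using (Rel; _⇒_)
open import Relation.Binary.Definitions using (Transitive)
open import Relation.Binary.PropositionalEquality
  using (_≡_; _≢_; refl; sym; trans; cong; cong₂; subst)
open import Relation.Nullary.Decidable
  using (Dec; yes; no; does; does-⇔; dec-true; _×-dec_)
open import Relation.Nullary.Negation using (¬_; contradiction)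
open import Relation.Unary using (Pred; Decidable; _≐_) renaming (_⊆_ to _⊆ᵖ_)

-- Finite sets

Least : ∀ {n} → Pred (Fin n) 0ℓ → Pred (Fin n) 0ℓ
Least P i = P i × (∀ {j} → j < i → ¬ P j)

least : ∀ {n} {P : Pred (Fin n) 0ℓ} → Decidable P → ∃ P → ∃ (Least P)
least {suc n} P? (i , p) with P? zero | i | p
... | yes p₀ | _     | _  = zero , p₀ , λ ()
... | no ¬p₀ | zero  | p₀ = contradiction p₀ ¬p₀
... | no ¬p₀ | suc i | p  =
  let (j , pj , min) = least (P? ∘ suc) (i , p)
  in suc j , pj , λ { {zero}  _         → ¬p₀
                     ; {suc _} (s≤s k<j) → min k<j
                     }

-- For two predicates, because active sets of different edge sets are compared only by mutual
-- inclusion.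
least-unique : ∀ {n} {P Q : Pred (Fin n) 0ℓ} → P ⊆ᵖ Q → Q ⊆ᵖ P →
               ∀ {i j} → Least P i → Least Q j → i ≡ j
least-unique P⊆Q Q⊆P (pi , mini) (qj , minj) =
  Fin.≤-antisym (ℕ.≮⇒≥ λ j<i → mini j<i (Q⊆P qj)) (ℕ.≮⇒≥ λ i<j → minj i<j (P⊆Q pi))

least-cong : ∀ {n} {P Q : Pred (Fin n) 0ℓ} → P ⊆ᵖ Q → Q ⊆ᵖ P → Least P ⊆ᵖ Least Q
least-cong P⊆Q Q⊆P (pi , min) = P⊆Q pi , λ j<i qj → min j<i (Q⊆P qj)

module _ {n : ℕ} where

  comprehension : {P : Pred (Fin n) 0ℓ} → Decidable P → Subset n
  comprehension P? = tabulate (does ∘ P?)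

  ∈-comprehension : {P : Pred (Fin n) 0ℓ} (P? : Decidable P) →
                    ∀ i → i ∈ comprehension P? ⇔ P i
  ∈-comprehension {P} P? i = mk⇔ to from
    where
    to : i ∈ comprehension P? → P i
    to i∈ with P? i | trans (sym (lookup∘tabulate (does ∘ P?) i)) ([]=⇒lookup i∈)
    ... | yes p | _ = p
    from : P i → i ∈ comprehension P?
    from p = lookup⇒[]= i _ (trans (lookup∘tabulate (does ∘ P?) i) (dec-true (P? i) p))

  x∈p⇒⁅x⁆⊆p : {p : Subset n} {x : Fin n} → x ∈ p → ⁅ x ⁆ ⊆ p
  x∈p⇒⁅x⁆⊆p x∈p y∈ with refl ← x∈⁅y⁆⇒x≡y _ y∈ = x∈p

  ∪-least : {p q r : Subset n} → p ⊆ r → q ⊆ r → p ∪ q ⊆ r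
  ∪-least {p} {q} p⊆r q⊆r x∈ = [ p⊆r , q⊆r ]′ (x∈p∪q⁻ p q x∈)

  x∈p∪⁅y⁆∧x≢y⇒x∈p : {p : Subset n} {x y : Fin n} → x ∈ p ∪ ⁅ y ⁆ → x ≢ y → x ∈ p
  x∈p∪⁅y⁆∧x≢y⇒x∈p {p} x∈ x≢y =
    [ id , (λ x∈⁅y⁆ → contradiction (x∈⁅y⁆⇒x≡y _ x∈⁅y⁆) x≢y) ]′ (x∈p∪q⁻ p _ x∈)

  -- Otherwise deleting `x` a second time would shrink `p - x` strictly, yet deletion is idempotent.
  x∉p-x : (p : Subset n) {x : Fin n} → x ∉ p - x
  x∉p-x p {x} x∈ = ⊂-irref (p─q─q≡p─q p ⁅ x ⁆) (x∈p⇒p-x⊂p x∈)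

  x∈p⇒[p-x]∪⁅x⁆≡p : {p : Subset n} {x : Fin n} → x ∈ p → (p - x) ∪ ⁅ x ⁆ ≡ p
  x∈p⇒[p-x]∪⁅x⁆≡p {p} {x} x∈p =
    ⊆-antisym (∪-least (p─q⊆p p ⁅ x ⁆) (x∈p⇒⁅x⁆⊆p x∈p)) back
    where
    back : p ⊆ (p - x) ∪ ⁅ x ⁆
    back {y} y∈p with y Fin.≟ x
    ... | yes refl = q⊆p∪q _ _ (x∈⁅x⁆ x)
    ... | no y≢x   = p⊆p∪q _ (x∈p∧x≢y⇒x∈p-y y∈p y≢x)

  ∪⁅x⁆-cancel : {p q : Subset n} {x : Fin n} → x ∉ p → x ∉ q →
                p ∪ ⁅ x ⁆ ≡ q ∪ ⁅ x ⁆ → p ≡ q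
  ∪⁅x⁆-cancel x∉p x∉q eq = ⊆-antisym (half x∉p eq) (half x∉q (sym eq))
    where
    half : ∀ {p q x} → x ∉ p → p ∪ ⁅ x ⁆ ≡ q ∪ ⁅ x ⁆ → p ⊆ q
    half x∉p eq y∈p = x∈p∪⁅y⁆∧x≢y⇒x∈p (subst (_ ∈_) eq (p⊆p∪q _ y∈p))
                        λ { refl → x∉p y∈p }

  x∉p⇒p⊂p∪⁅x⁆ : {p : Subset n} {x : Fin n} → x ∉ p → p ⊂ p ∪ ⁅ x ⁆
  x∉p⇒p⊂p∪⁅x⁆ {x = x} x∉p = p⊆p∪q _ , x , q⊆p∪q _ _ (x∈⁅x⁆ x) , x∉p

  x∉p⇒p⋖p∪⁅x⁆ : {p : Subset n} {x : Fin n} → x ∉ p → p ⋖ p ∪ ⁅ x ⁆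
  x∉p⇒p⋖p∪⁅x⁆ {p} {x} x∉p = x∉p⇒p⊂p∪⁅x⁆ x∉p , nothing-between
    where
    nothing-between : ¬ (∃[ u ] p ⊂ u × u ⊂ p ∪ ⁅ x ⁆)
    nothing-between (u , (p⊆u , y , y∈u , y∉p) , (u⊆ , z , z∈ , z∉u)) with y Fin.≟ x
    ... | yes refl = z∉u (∪-least p⊆u (x∈p⇒⁅x⁆⊆p y∈u) z∈)
    ... | no y≢x   = y∉p (x∈p∪⁅y⁆∧x≢y⇒x∈p (u⊆ y∈u) y≢x)

  -- An element of `q` outside `p ∪ ⁅ x ⁆` would put that set strictly between `p` and `q`.
  ⋖⇒≡∪⁅x⁆ : {p q : Subset n} {x : Fin n} → p ⋖ q → x ∈ q → x ∉ p → q ≡ p ∪ ⁅ x ⁆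
  ⋖⇒≡∪⁅x⁆ {p} {q} {x} ((p⊆q , _) , nothing-between) x∈q x∉p = ⊆-antisym q⊆ p∪x⊆q
    where
    p∪x⊆q : p ∪ ⁅ x ⁆ ⊆ q
    p∪x⊆q = ∪-least p⊆q (x∈p⇒⁅x⁆⊆p x∈q)
    q⊆ : q ⊆ p ∪ ⁅ x ⁆
    q⊆ {y} y∈q with y ∈? p ∪ ⁅ x ⁆
    ... | yes y∈ = y∈
    ... | no y∉  =
      ⊥-elim (nothing-between (p ∪ ⁅ x ⁆ , x∉p⇒p⊂p∪⁅x⁆ x∉p , (p∪x⊆q , y , y∈q , y∉)))

  pair-injective : {u v u′ v′ : Fin n} → ⁅ u ⁆ ∪ ⁅ v ⁆ ≡ ⁅ u′ ⁆ ∪ ⁅ v′ ⁆ →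
                   (u ≡ u′ × v ≡ v′) ⊎ (u ≡ v′ × v ≡ u′)
  pair-injective {u} {v} {u′} {v′} eq
    with member {u} eq (p⊆p∪q _ (x∈⁅x⁆ u)) | member {v} eq (q⊆p∪q _ _ (x∈⁅x⁆ v))
       | member {u′} (sym eq) (p⊆p∪q _ (x∈⁅x⁆ u′)) | member {v′} (sym eq) (q⊆p∪q _ _ (x∈⁅x⁆ v′))
    where
    member : ∀ {w a b c d} → ⁅ a ⁆ ∪ ⁅ b ⁆ ≡ ⁅ c ⁆ ∪ ⁅ d ⁆ → w ∈ ⁅ a ⁆ ∪ ⁅ b ⁆ →
             w ≡ c ⊎ w ≡ d
    member {c = c} {d} eq w∈ =
      [ inj₁ ∘ x∈⁅y⁆⇒x≡y c , inj₂ ∘ x∈⁅y⁆⇒x≡y d ]′ (x∈p∪q⁻ _ _ (subst (_ ∈_) eq w∈))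
  ... | inj₁ p    | inj₂ q    | _         | _         = inj₁ (p , q)
  ... | inj₂ p    | inj₁ q    | _         | _         = inj₂ (p , q)
  -- When `u` and `v` match the same element, the left side is a singleton, and the memberships of
  -- `u′` and `v′` in it make all four coincide.
  ... | inj₁ refl | inj₁ refl | _         | inj₁ refl = inj₁ (refl , refl)
  ... | inj₁ refl | inj₁ refl | _         | inj₂ refl = inj₁ (refl , refl)
  ... | inj₂ refl | inj₂ refl | inj₁ refl | _         = inj₁ (refl , refl)
  ... | inj₂ refl | inj₂ refl | inj₂ refl | _         = inj₁ (refl , refl)

-- Matchings toggling the least active element

module ToggleMatching
  {m : ℕ} (Active : Subset m → Pred (Fin m) 0ℓ)
  (active? : ∀ S → Decidable (Active S))
  (active-mono : ∀ {S T} → S ⊆ T → Active S ⊆ᵖ Active T)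
  (active-insert : ∀ {S e} → Active S e → Active (S ∪ ⁅ e ⁆) ⊆ᵖ Active S)
  (active-delete : ∀ {S e} → Active S e → Active (S - e) e)
  where

  -- Activity is required in the lower set only: by `active-mono` and `active-insert` the upper set
  -- has the same active elements, so `e` is least in both.
  M : Rel (Subset m) 0ℓ
  M S T = ∃[ e ] Least (Active S) e × e ∉ S × T ≡ S ∪ ⁅ e ⁆

  M⇒active⊆ : ∀ {S T} → M S T → Active S ⊆ᵖ Active T
  M⇒active⊆ (e , _ , _ , refl) = active-mono (p⊆p∪q ⁅ e ⁆)

  M⇒active⊇ : ∀ {S T} → M S T → Active T ⊆ᵖ Active S
  M⇒active⊇ (_ , (active , _) , _ , refl) = active-insert active

  isMatching : IsMatching _⋖_ M
  isMatching = record
    { edges    = λ { (_ , _ , e∉S , refl) → x∉p⇒p⋖p∪⁅x⁆ e∉S }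
    ; disjoint = λ Mab Mcd s t → disjoint s t Mab Mcd
    }
    where
    disjoint : ∀ {a b c d v} → Endpoint v (a , b) → Endpoint v (c , d) →
               M a b → M c d → (a , b) ≡ (c , d)
    disjoint {a} source source (_ , le , _ , refl) (_ , le′ , _ , refl) =
      cong (λ e → a , a ∪ ⁅ e ⁆) (least-unique id id le le′)
    disjoint source target (_ , le , e∉a , refl) Mcd@(_ , le′ , _ , refl)
      with refl ← least-unique (M⇒active⊇ Mcd) (M⇒active⊆ Mcd) le le′ =
      contradiction (q⊆p∪q _ _ (x∈⁅x⁆ _)) e∉a
    disjoint target source Mab@(_ , le , _ , refl) (_ , le′ , e′∉c , refl)
      with refl ← least-unique (M⇒active⊆ Mab) (M⇒active⊇ Mab) le le′ =
      contradiction (q⊆p∪q _ _ (x∈⁅x⁆ _)) e′∉c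
    -- Both lower sets have the active elements of their common upper set, hence the same `e`, which
    -- can be cancelled.
    disjoint target target Mab@(_ , le , e∉a , v≡) Mcd@(_ , le′ , e∉c , v≡′)
      with refl ← least-unique
             (λ x → M⇒active⊇ Mcd (M⇒active⊆ Mab x))
             (λ x → M⇒active⊇ Mab (M⇒active⊆ Mcd x)) le le′
      with refl ← ∪⁅x⁆-cancel e∉a e∉c (trans (sym v≡) v≡′) = refl

  Drops : Rel (Subset m) 0ℓ
  Drops a b = ∃[ e ] Least (Active a) e × e ∈ a × e ∉ b

  -- What survives of unmatched covers along a walk. Quantifying over every least active element
  -- makes the clause vacuous when nothing is active.
  Rises : Rel (Subset m) 0ℓ
  Rises a b = a ⊂ b × (∀ {e} → Least (Active a) e → e ∈ b → e ∈ a)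

  -- A strict partial order containing the modified Hasse diagram: first compare
  -- the active sets, then whether the least active element is absent, then the
  -- sets themselves.
  infix 4 _≺_
  _≺_ : Rel (Subset m) 0ℓ
  a ≺ b = Active a ⊆ᵖ Active b × (Active b ⊆ᵖ Active a → Drops a b ⊎ Rises a b)

  ≺-irrefl : ∀ {a} → ¬ a ≺ a
  ≺-irrefl (_ , cmp) with cmp id
  ... | inj₁ (_ , _ , e∈a , e∉a) = e∉a e∈a
  ... | inj₂ (a⊂a , _)           = ⊂-irref refl a⊂a

  -- If the outer active sets agree, the middle one is squeezed between them, so all three share
  -- their least element and the second components are comparable.
  ≺-trans : Transitive _≺_
  ≺-trans {a} {b} {c} (a⊆b , ab) (b⊆c , bc) =
    (λ x → b⊆c (a⊆b x)) , λ c⊆a → combine c⊆a (ab (λ x → c⊆a (b⊆c x))) (bc (λ x → a⊆b (c⊆a x)))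
    where
    module _ (c⊆a : Active c ⊆ᵖ Active a) where
      a⇒b : Least (Active a) ⊆ᵖ Least (Active b)
      a⇒b = least-cong a⊆b (λ x → c⊆a (b⊆c x))
      b⇒a : Least (Active b) ⊆ᵖ Least (Active a)
      b⇒a = least-cong (λ x → c⊆a (b⊆c x)) a⊆b
      combine : Drops a b ⊎ Rises a b → Drops b c ⊎ Rises b c → Drops a c ⊎ Rises a c
      -- Two drops cannot follow each other, as the first has already removed `e`. A drop absorbs a
      -- rise on either side, since rises never gain `e`.
      combine (inj₁ (e , le , e∈a , e∉b)) (inj₁ (_ , le′ , e′∈b , _))
        with refl ← least-unique id id (a⇒b le) le′ = contradiction e′∈b e∉b
      combine (inj₁ (e , le , e∈a , e∉b)) (inj₂ (_ , keep)) =
        inj₁ (e , le , e∈a , λ e∈c → e∉b (keep (a⇒b le) e∈c))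
      combine (inj₂ (_ , keep)) (inj₁ (e , le , e∈b , e∉c)) =
        inj₁ (e , b⇒a le , keep (b⇒a le) e∈b , e∉c)
      combine (inj₂ (a⊂b , keep)) (inj₂ (b⊂c , keep′)) =
        inj₂ (⊂-trans a⊂b b⊂c , λ le e∈c → keep le (keep′ (a⇒b le) e∈c))

  -- A cover that gains the least active element is a matched pair, so unmatched covers rise. A
  -- reversed pair keeps the active set and loses that element.
  reverse⇒≺ : Reverse _⋖_ M ⇒ _≺_
  reverse⇒≺ {a} {b} (inj₁ (a⋖b , ¬Mab)) =
    active-mono (proj₁ (proj₁ a⋖b)) , λ _ → inj₂ (proj₁ a⋖b , keep)
    where
    keep : ∀ {e} → Least (Active a) e → e ∈ b → e ∈ a
    keep {e} le e∈b with e ∈? a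
    ... | yes e∈a = e∈a
    ... | no e∉a  = contradiction (e , le , e∉a , ⋖⇒≡∪⁅x⁆ a⋖b e∈b e∉a) ¬Mab
  reverse⇒≺ (inj₂ Mba@(e , le , e∉b , refl)) =
    M⇒active⊇ Mba , λ _ →
    inj₁ (e , least-cong (M⇒active⊆ Mba) (M⇒active⊇ Mba) le , q⊆p∪q _ _ (x∈⁅x⁆ e) , e∉b)

  acyclic : NoDirectedCycle (Reverse _⋖_ M)
  acyclic refl walk = ≺-irrefl (walk⇒≺ walk)
    where
    walk⇒≺ : TransClosure (Reverse _⋖_ M) ⇒ _≺_
    walk⇒≺ [ r ]    = reverse⇒≺ r
    walk⇒≺ (r ∷ rs) = ≺-trans (reverse⇒≺ r) (walk⇒≺ rs)

  isAcyclicMatching : IsAcyclicMatching _⋖_ M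
  isAcyclicMatching = record { isMatching = isMatching ; acyclic = acyclic }

  critical⇒inactive : ∀ {S} → Critical M S → ¬ ∃ (Active S)
  critical⇒inactive {S} critical active with least (active? S) active
  ... | e , le@(act , _) with e ∈? S
  ...   | no e∉S  = critical (_ , _ , (e , le , e∉S , refl) , source)
  ...   | yes e∈S = critical (_ , _ , (e , le′ , x∉p-x S , sym S≡) , target)
    where
    S≡ : (S - e) ∪ ⁅ e ⁆ ≡ S
    S≡ = x∈p⇒[p-x]∪⁅x⁆≡p e∈S
    -- `e` is still active in `S - e`, so putting it back changes no activity.
    le′ : Least (Active (S - e)) e
    le′ = least-cong
      (λ {f} x → active-insert (active-delete act) (subst (λ T → Active T f) (sym S≡) x))
      (active-mono (p─q⊆p S ⁅ e ⁆)) le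

  inactive⇒critical : ∀ {S} → ¬ ∃ (Active S) → Critical M S
  inactive⇒critical inactive (_ , _ , (e , (act , _) , _) , source) = inactive (e , act)
  inactive⇒critical inactive (_ , _ , Mab@(e , (act , _) , _) , target) =
    inactive (e , M⇒active⊆ Mab act)

-- Simple paths and cyclic indices

record SimplePath {A : Set} (R : Rel A 0ℓ) (u v : A) : Set where
  field
    len       : ℕ
    x         : Fin (suc len) → A
    start     : x zero ≡ u
    end       : x (fromℕ len) ≡ v
    step      : ∀ i → R (x (inject₁ i)) (x (suc i))
    injective : Injective _≡_ _≡_ x

module _ {n : ℕ} {R : Rel (Fin n) 0ℓ} where

  open SimplePath

  startAt : ∀ {u v} (p : SimplePath R u v) (i : Fin (suc (len p))) → SimplePath R (x p i) v
  startAt p i = go (x p) (end p) (step p) (injective p) i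
    where
    go : ∀ {ℓ v} (x : Fin (suc ℓ) → Fin n) → x (fromℕ ℓ) ≡ v →
         (∀ i → R (x (inject₁ i)) (x (suc i))) → Injective _≡_ _≡_ x →
         ∀ i → SimplePath R (x i) v
    go x e s inj zero = record { x = x ; start = refl ; end = e ; step = s ; injective = inj }
    go {suc _} x e s inj (suc i) = go (x ∘ suc) e (s ∘ suc) (Fin.suc-injective ∘ inj) i

  -- Prepending `u` keeps the path simple unless `u` already occurs on it; then the part from that
  -- occurrence on is taken.
  star⇒simplePath : Star R ⇒ SimplePath R
  star⇒simplePath {u} ε = record
    { len = 0 ; x = λ _ → u ; start = refl ; end = refl ; step = λ ()
    ; injective = λ { {zero} {zero} _ → refl } }
  star⇒simplePath {u} (r ◅ rs) with star⇒simplePath rs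
  ... | p with any? (λ i → x p i Fin.≟ u)
  ...   | yes (i , refl) = startAt p i
  ...   | no fresh = record
    { len       = suc (len p)
    ; x         = u ◂ x p
    ; start     = refl
    ; end       = end p
    ; step      = λ { zero → subst (R u) (sym (start p)) r ; (suc i) → step p i }
    ; injective = λ { {zero}  {zero}  _  → refl
                    ; {zero}  {suc j} eq → contradiction (j , sym eq) fresh
                    ; {suc i} {zero}  eq → contradiction (i , eq) fresh
                    ; {suc i} {suc j} eq → cong suc (injective p eq)
                    }
    }

next-inject₁ : ∀ {k} (j : Fin k) → next (inject₁ j) ≡ suc j
next-inject₁ {k} j = Fin.toℕ-injective (trans (Fin.toℕ-fromℕ< _)
  (trans (cong (λ t → suc t ℕ.% suc k) (Fin.toℕ-inject₁ j))
         (m<n⇒m%n≡m (s≤s (Fin.toℕ<n j)))))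

next-fromℕ : ∀ k → next (fromℕ k) ≡ zero
next-fromℕ k = Fin.toℕ-injective (trans (Fin.toℕ-fromℕ< _)
  (trans (cong (λ t → suc t ℕ.% suc k) (Fin.toℕ-fromℕ k)) (n%n≡0 (suc k))))

-- The last index goes to 1, the one before it to 0, and any other rises by 2. This keeps a cycle
-- from running through one edge in both directions.
next∘next≢id : ∀ {k} → 3 ℕ.≤ k → (i : Fin k) → next (next i) ≢ i
next∘next≢id (s≤s (s≤s (s≤s _))) i eq with view i
... | ‵fromℕ with () ← trans (sym (trans (cong next (next-fromℕ _)) (next-inject₁ zero))) eq
... | ‵inject₁ j with view j
...   | ‵fromℕ
  with () ← trans (sym (trans (cong next (next-inject₁ (fromℕ _))) (next-fromℕ _))) eq
...   | ‵inject₁ j′ = ℕ.m≢1+n+m (toℕ j′) {1} (sym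
  (trans (cong toℕ (trans (sym (trans (cong next (next-inject₁ (inject₁ j′)))
                                     (next-inject₁ (suc j′)))) eq))
         (trans (Fin.toℕ-inject₁ (inject₁ j′)) (Fin.toℕ-inject₁ j′))))

-- Going backwards from i around the cycle reaches every index before the step
-- out of i is needed.
next-induction : ∀ {k} (P : Pred (Fin k) 0ℓ) (i : Fin k) → P i →
                 (∀ j → j ≢ i → P (next j) → P j) → ∀ j → P j
next-induction {suc k} P i Pi back = >-weakInduction P Plast Pinject₁
  where
  back′ : ∀ j → P (next j) → P j
  back′ j Pnext with j Fin.≟ i
  ... | yes refl = Pi
  ... | no j≢i   = back j j≢i Pnext
  Pinject₁ : ∀ j → P (suc j) → P (inject₁ j)
  Pinject₁ j Psuc = back′ (inject₁ j) (subst P (sym (next-inject₁ j)) Psuc)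
  -- The descent goes from `i` to `zero`, wraps around to the last index in `Plast`, and from there
  -- covers all indices.
  below : ∀ j → j ≤ i → P j
  below = >-weakInduction (λ j → j ≤ i → P j)
    (λ k≤i → subst P (Fin.≤-antisym (Fin.≤fromℕ i) k≤i) Pi)
    λ j IH j≤i → case inject₁ j Fin.≟ i of λ where
      (yes refl) → Pi
      (no j≢i)   → Pinject₁ j (IH (subst (ℕ._< toℕ i) (Fin.toℕ-inject₁ j)
                     (ℕ.≤∧≢⇒< j≤i (j≢i ∘ Fin.toℕ-injective))))
  Plast : P (fromℕ k)
  Plast = back′ (fromℕ k) (subst P (sym (next-fromℕ k)) (below zero z≤n))

-- Active edges of a graph

module _ (G : Graph) where

  open Graph G

  AdjacentBy : Pred (Fin m) 0ℓ → Rel (Fin n) 0ℓ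
  AdjacentBy P u v = ∃[ e ] P e × Joins G e u v

  Reach : Pred (Fin m) 0ℓ → Rel (Fin n) 0ℓ
  Reach P = Star (AdjacentBy P)

  -- The closure of `P` in the cycle matroid of the graph.
  Spanned : Pred (Fin m) 0ℓ → Pred (Fin m) 0ℓ
  Spanned P e = ∃[ u ] ∃[ v ] Joins G e u v × Reach P u v

  joins-sym : ∀ {e u v} → Joins G e u v → Joins G e v u
  joins-sym {u = u} {v} j = trans j (∪-comm ⁅ u ⁆ ⁅ v ⁆)

  joins-irrefl : ∀ {e u} → ¬ Joins G e u u
  joins-irrefl {e} {u} j = case trans (sym (edge-size e))
    (trans (cong ∣_∣ (trans j (∪-idem ⁅ u ⁆))) (∣⁅x⁆∣≡1 u)) of λ ()

  joins-unique : ∀ {e f u v} → Joins G e u v → Joins G f u v → e ≡ f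
  joins-unique j j′ = edge-injective (trans j (sym j′))

  reach-sym : ∀ {P u v} → Reach P u v → Reach P v u
  reach-sym = reverse λ { (e , p , j) → e , p , joins-sym j }

  -- Each edge missing from `Q` is replaced by the `Q`-walk between its ends, reversed if the ends
  -- come in the other order.
  reach-subst : ∀ {P Q} → (∀ {e} → P e → Q e ⊎ Spanned Q e) → Reach P ⇒ Reach Q
  reach-subst {P} {Q} h = kleisliStar id step
    where
    step : AdjacentBy P ⇒ Reach Q
    step (e , p , j) with h p
    ... | inj₁ q = return (e , q , j)
    ... | inj₂ (_ , _ , j′ , r) with pair-injective (trans (sym j) j′)
    ...   | inj₁ (refl , refl) = r
    ...   | inj₂ (refl , refl) = reach-sym r

  spanned-subst : ∀ {P Q} → (∀ {e} → P e → Q e ⊎ Spanned Q e) → Spanned P ⊆ᵖ Spanned Q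
  spanned-subst h (u , v , j , r) = u , v , j , reach-subst h r

  spanned-mono : ∀ {P Q} → P ⊆ᵖ Q → Spanned P ⊆ᵖ Spanned Q
  spanned-mono P⊆Q = spanned-subst (inj₁ ∘ P⊆Q)

  Below : Subset m → Fin m → Pred (Fin m) 0ℓ
  Below S e f = f ∈ S × f < e

  Active : Subset m → Pred (Fin m) 0ℓ
  Active S e = Spanned (Below S e) e

  active? : ∀ S → Decidable (Active S)
  active? S e = any? λ u → any? λ v →
    (edge e ≟ˢ (⁅ u ⁆ ∪ ⁅ v ⁆)) ×-dec Reachability.star? adjacentBelow? u v
    where
    adjacentBelow? : ∀ u v → Dec (AdjacentBy (Below S e) u v)
    adjacentBelow? u v = any? λ f →
      ((f ∈? S) ×-dec (f Fin.<? e)) ×-dec (edge f ≟ˢ (⁅ u ⁆ ∪ ⁅ v ⁆))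

  active-mono : ∀ {S T} → S ⊆ T → Active S ⊆ᵖ Active T
  active-mono S⊆T = spanned-mono λ { (f∈S , f<e) → S⊆T f∈S , f<e }

  -- A walk below `f` that uses `e` can detour along the walk that makes `e` active: its edges are
  -- below `e`, hence below `f`.
  active-insert : ∀ {S e} → Active S e → Active (S ∪ ⁅ e ⁆) ⊆ᵖ Active S
  active-insert {S} {e} active {f} = spanned-subst replace
    where
    replace : ∀ {g} → Below (S ∪ ⁅ e ⁆) f g → Below S f g ⊎ Spanned (Below S f) g
    replace {g} (g∈ , g<f) with g Fin.≟ e
    ... | yes refl =
      inj₂ (spanned-mono (λ { (h∈S , h<g) → h∈S , ℕ.<-trans h<g g<f }) active)
    ... | no g≢e = inj₁ (x∈p∪⁅y⁆∧x≢y⇒x∈p g∈ g≢e , g<f)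

  active-delete : ∀ {S e} → Active S e → Active (S - e) e
  active-delete = spanned-mono λ { (f∈S , f<e) →
    x∈p∧x≢y⇒x∈p-y f∈S (λ { refl → ℕ.<-irrefl refl f<e }) , f<e }

  connected-insert : ∀ {S e} → Active S e → ∀ {u v} →
                     Connected G S u v ⇔ Connected G (S ∪ ⁅ e ⁆) u v
  connected-insert {S} {e} active =
    mk⇔ (reach-subst (inj₁ ∘ p⊆p∪q ⁅ e ⁆)) (reach-subst replace)
    where
    replace : ∀ {g} → g ∈ S ∪ ⁅ e ⁆ → g ∈ S ⊎ Spanned (_∈ S) g
    replace {g} g∈ with g Fin.≟ e
    ... | yes refl = inj₂ (spanned-mono proj₁ active)
    ... | no g≢e   = inj₁ (x∈p∪⁅y⁆∧x≢y⇒x∈p g∈ g≢e)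

  -- Unchanged connectivity fixes every entry of every block, so even the lists agree; this settles
  -- both `k` and `λ`.
  components-insert : ∀ {S e} → Active S e → components G S ≡ components G (S ∪ ⁅ e ⁆)
  components-insert {S} active = cong (deduplicate _≟ˢ_) (map-cong
    (λ v → tabulate-cong λ w →
       does-⇔ (connected-insert active) (connected? G S v w) (connected? G _ v w))
    (allFin n))

  -- The rest of the cycle, from `x (next i)` round to `x i`, joins the ends of `e` by edges of
  -- `C - e`, all smaller than `e`.
  brokenCircuit⇒active : ∀ {S B} → IsBrokenCircuit G B → B ⊆ S → ∃ (Active S)
  brokenCircuit⇒active {S} (C , e , cycle , e∈C , e-max , refl) C-e⊆S =
    let (i , joins) = to (edgeSet e) e∈C
    in e , x (next i) , x i , joins-sym joins ,
       next-induction (λ j → Reach (Below S e) (x j) (x i)) i ε (back i joins) (next i)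
    where
    open IsCycle cycle
    open Equivalence
    back : ∀ i → Joins G e (x i) (x (next i)) → ∀ j → j ≢ i →
           Reach (Below S e) (x (next j)) (x i) → Reach (Below S e) (x j) (x i)
    back i joins j j≢i r = (f , (f∈S , f<e) , joins′) ◅ r
      where
      f : Fin m
      f = proj₁ (closed j)
      joins′ : Joins G f (x j) (x (next j))
      joins′ = proj₂ (closed j)
      f∈C : f ∈ C
      f∈C = from (edgeSet f) (j , joins′)
      f≢e : f ≢ e
      f≢e f≡e with pair-injective (trans (sym joins′) (trans (cong edge f≡e) joins))
      ... | inj₁ (xj≡xi , _) = j≢i (distinct xj≡xi)
      -- Traversing `e` backwards at `j` would make `i` and `j` successors of each other.
      ... | inj₂ (xj≡xni , xnj≡xi) = next∘next≢id 3≤k i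
        (trans (cong next (sym (distinct xj≡xni))) (distinct xnj≡xi))
      f∈S : f ∈ S
      f∈S = C-e⊆S (x∈p∧x≢y⇒x∈p-y f∈C f≢e)
      f<e : f < e
      f<e = Fin.≤∧≢⇒< (e-max f f∈C) f≢e

  -- The walk is shortened to a simple path, which `e` closes to a cycle. All path edges are below
  -- `e`, so `e` is its largest edge.
  active⇒brokenCircuit : ∀ {S} → ∃ (Active S) → ∃[ B ] IsBrokenCircuit G B × B ⊆ S
  active⇒brokenCircuit {S} (e , u , v , joins , walk) =
    C - e , (C , e , cycle , e∈C , e-max , refl) , C-e⊆S
    where
    open SimplePath (star⇒simplePath walk) renaming (len to ℓ)
    open Equivalence

    joins-end : Joins G e (x (fromℕ ℓ)) (x (next (fromℕ ℓ)))
    joins-end = trans (joins-sym joins) (sym (cong₂ (λ a b → ⁅ a ⁆ ∪ ⁅ b ⁆) end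
      (trans (cong x (next-fromℕ ℓ)) start)))

    joins-step : ∀ {f} i → Joins G f (x (inject₁ i)) (x (suc i)) →
                 Joins G f (x (inject₁ i)) (x (next (inject₁ i)))
    joins-step i = subst (λ j → Joins G _ (x (inject₁ i)) (x j)) (sym (next-inject₁ i))

    3≤1+length : ∀ {ℓ} (x : Fin (suc ℓ) → Fin n) → x zero ≡ u → x (fromℕ ℓ) ≡ v →
                 (∀ i → AdjacentBy (Below S e) (x (inject₁ i)) (x (suc i))) → 3 ℕ.≤ suc ℓ
    -- Length 0 would make `e` a loop; length 1 would give a smaller edge with the same ends as `e`.
    3≤1+length {0} x refl refl step = contradiction joins joins-irrefl
    3≤1+length {1} x refl refl step with step zero
    ... | f , (_ , f<e) , j with refl ← joins-unique joins j = contradiction f<e (ℕ.<-irrefl refl)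
    3≤1+length {suc (suc _)} x _ _ step = s≤s (s≤s (s≤s z≤n))

    onCycle? : Decidable (λ f → ∃[ i ] Joins G f (x i) (x (next i)))
    onCycle? f = any? λ i → edge f ≟ˢ (⁅ x i ⁆ ∪ ⁅ x (next i) ⁆)

    C : Subset m
    C = comprehension onCycle?

    closed : ∀ i → ∃[ f ] Joins G f (x i) (x (next i))
    closed i with view i
    ... | ‵fromℕ     = e , joins-end
    ... | ‵inject₁ j with step j
    ...   | f , _ , joins′ = f , joins-step j joins′

    cycle : IsCycle G C
    cycle = record
      { k        = suc ℓ
      ; 3≤k      = 3≤1+length x start end step
      ; x        = x
      ; distinct = injective
      ; closed   = closed
      ; edgeSet  = ∈-comprehension onCycle?
      }

    e∈C : e ∈ C
    e∈C = from (∈-comprehension onCycle? e) (fromℕ ℓ , joins-end)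

    classify : ∀ {f} → f ∈ C → f ≡ e ⊎ Below S e f
    classify {f} f∈C with to (∈-comprehension onCycle? f) f∈C
    ... | i , joins′ with view i
    ...   | ‵fromℕ = inj₁ (joins-unique joins′ joins-end)
    ...   | ‵inject₁ j with step j
    -- There are no parallel edges, so the edge `g` supplied by the path is `f`.
    ...     | g , below , joins″ with refl ← joins-unique joins′ (joins-step j joins″) = inj₂ below

    e-max : ∀ f → f ∈ C → f ≤ e
    e-max f f∈C with classify f∈C
    ... | inj₁ refl      = ℕ.≤-refl
    ... | inj₂ (_ , f<e) = ℕ.<⇒≤ f<e

    C-e⊆S : C - e ⊆ S
    C-e⊆S f∈ with classify (p─q⊆p C ⁅ e ⁆ f∈)
    ... | inj₁ refl      = contradiction f∈ (x∉p-x C)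
    ... | inj₂ (f∈S , _) = f∈S

lemma4p3 : (G : Graph) →
    Σ[ M ∈ Rel (Subset (Graph.m G)) 0ℓ ]
    ( IsAcyclicMatching _⋖_ M
    × (∀ {S S'} → M S S' →
    #components G S ≡ #components G S'
    × (components G S ∼[ set ] components G S'))
    × Critical M ≐ NBC G )
lemma4p3 G = M , isAcyclicMatching , same-components , critical⊆NBC , NBC⊆critical
  where
  open ToggleMatching (Active G) (active? G) (active-mono G) (active-insert G) (active-delete G)

  same-components : ∀ {S S'} → M S S' →
    #components G S ≡ #components G S' × (components G S ∼[ set ] components G S')
  same-components {S} (_ , (active , _) , _ , refl) = cong length eq ,
    λ {z} → subst (λ blocks → z ∈ˡ components G S ⇔ z ∈ˡ blocks) eq K-refl
    where eq = components-insert G active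

  critical⊆NBC : Critical M ⊆ᵖ NBC G
  critical⊆NBC critical (B , broken , B⊆S) =
    critical⇒inactive critical (brokenCircuit⇒active G broken B⊆S)

  NBC⊆critical : NBC G ⊆ᵖ Critical M
  NBC⊆critical nbc = inactive⇒critical (nbc ∘ active⇒brokenCircuit G)
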